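{- Let $\mathbb H$ be a hyperfield and let $M$ be a matroid (on a finite ground set) without minors isomorphic to the Fano matroid or its dual. Then, up to permuting the $k_M=3n_M$ variables, the set $\mathcal G^{R,w}_{\mathbb H}(M)$ of reduced $\mathbb H^*$-cross-ratios equals $$\mathcal B\cap\prod_{j=1}^{n_M}\left(X_{\mathbb H}\times\mathbb H^*\right)\subseteq(\mathbb H^*)^{3n_M}.$$
   Context: A hyperfield is $(\mathbb H,\boxplus,\odot,0,1)$ with $0\ne1$ where: $\boxplus$ is a commutative, associative hyperoperation (each $a\boxplus b$ is a nonempty subset of $\mathbb H$; for subsets, $A\boxplus B=\bigcup_{a\in A,b\in B}a\boxplus b$) with $0\boxplus x=\{x\}$, each $x$ has a unique $-x$ with $0\in x\boxplus -x$, and $x\in y\boxplus z\iff z\in x\boxplus -y$; $(\mathbb H,\odot,1)$ is a commutative monoid, $0\odot x=0$, $a\odot(x\boxplus y)=(a\odot x)\boxplus(a\odot y)$; and $\mathbb H^*=\mathbb H\setminus\{0\}$ is a group under $\odot$. Put $X_{\mathbb H}=\{(u,v)\in\mathbb H^*\times\mathbb H^*: 1\in u\boxplus v\}$. For a union $F$ of circuits of $M$ put $\dim F=|F|-\operatorname{rk}(F)-1$. Fix an enumeration $\{C_j\}_{j\in J}$ of the circuits of $M$ and a total order on $J$. Let $K$ be the set of quadruples $(j_1,j_2,j_3,j_4)$ of pairwise distinct elements of $J$ with $\dim(C_{j_1}\cup\dots\cup C_{j_4})=1$, $j_1<j_2$, $j_3<j_4$, $j_1<j_3$; $k_M=|K|$;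 let $n_M$ be the number of $j_1<j_2<j_3<j_4$ in $J$ with $\dim(C_{j_1}\cup\dots\cup C_{j_4})=1$, so $k_M=3n_M$. Consider functions $\phi:K\to\mathbb H^*$, written $\phi(C_{j_1}C_{j_2}|C_{j_3}C_{j_4})$; i.e. points of $(\mathbb H^*)^{k_M}$. For $a,b,c,e\in J$ with $\{a,b\}\cap\{c,e\}=\emptyset$ and $\dim(C_a\cup C_b\cup C_c\cup C_e)=1$, let $\langle ab|ce\rangle=1$ if $a=b$ or $c=e$; otherwise let $\langle ab|ce\rangle=\phi(C_pC_q|C_rC_s)^{\pm1}$, where $p<q$, $r<s$, $p<r$ are obtained by sorting each of the pairs $\{a,b\}$, $\{c,e\}$ increasingly and putting the pair with smaller minimum first, with exponent $+1$ if ($a<b$ and $c<e$) or ($a>b$ and $c>e$), and $-1$ otherwise. Relations: (S3) $\phi(C_{j_1}C_{j_2}|C_{j_3}C_{j_4})\odot\phi(C_{j_1}C_{j_4}|C_{j_2}C_{j_3})\odot\phi(C_{j_1}C_{j_3}|C_{j_2}C_{j_4})^{ -1}=-1$ for $j_1<j_2<j_3<j_4$ with $\dim(C_{j_1}\cup\dots\cup C_{j_4})=1$; (S4) for every five-element subset $\{p,q,r,s,t\}\subseteq J$ with $\dim(C_p\cup C_q\cup C_r\cup C_s\cup C_t)=1$, $p<q$, $r<s<t$: $\langle pq|rs\rangle\odot\langle pq|st\rangle\odot\langle pq|rt\rangle^{ -1}=1$; (S5) $\langle j_1j_2|j_6j_9\rangle\odot\langle j_2j_3|j_4j_7\rangle\odot\langle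 j_3j_1|j_5j_8\rangle=1$ for every family of circuits $C_{j_1},\dots,C_{j_9}$ such that: $L_p:=C_{j_q}\cup C_{j_r}$ has dimension $1$ for $\{p,q,r\}=\{1,2,3\}$; $\dim(C_{j_1}\cup C_{j_2}\cup C_{j_3})=2$; $C_{j_{s+3}},C_{j_{s+6}}\subseteq L_s$ for $s=1,2,3$; $\dim(C_{j_4}\cup C_{j_5}\cup C_{j_6})=\dim(C_{j_7}\cup C_{j_8}\cup C_{j_9})=1$; $\{C_{j_1},C_{j_2},C_{j_3}\}\cap\{C_{j_4},\dots,C_{j_9}\}=\emptyset$; $j_1<j_2<j_3$; and $j_4\ge j_7$, $j_5\ge j_8$, $j_6\ge j_9$ do not all hold; (CR) $1\in\phi(C_{j_1}C_{j_2}|C_{j_3}C_{j_4})\boxplus\phi(C_{j_1}C_{j_3}|C_{j_2}C_{j_4})$ for $j_1<j_2<j_3<j_4$ with $\dim(C_{j_1}\cup\dots\cup C_{j_4})=1$. $\mathcal B\subseteq(\mathbb H^*)^{k_M}$ is the set of solutions of (S3), (S4), (S5); $\mathcal G^{R,w}_{\mathbb H}(M)$ is the set of $\phi$ satisfying (S3), (S4), (S5) and (CR). -}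

module Defs where

open import Algebra.Structures using (IsCommutativeMonoid; IsGroup)
open import Data.Bool.Base using (Bool; true; false; T; _∧_; if_then_else_)
import Data.Bool.Properties as Bool
open import Data.Empty using (⊥-elim)
open import Data.Fin.Base using (Fin; zero; suc; combine)
open import Data.Fin.Patterns
import Data.Fin.Properties as Fin
open import Data.Fin.Subset
  using (Subset; inside; outside; ⊤; ⊥; ⁅_⁆; _∈_; _∉_; _⊆_; _⊂_; _∪_; _∩_; _─_; ∁; ∣_∣)
open import Data.Fin.Subset.Properties
open import Data.Integer.Base using (ℤ; _-_; 1ℤ) renaming (+_ to pos; _+_ to _+ℤ_)
import Data.Integer.Properties as ℤ
import Data.Integer.Solver as ℤSolver
open import Data.Irrelevant using ([_])
open import Data.List.Base
  using (List; []; _∷_; length; filter; allFin; cartesianProduct)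
import Data.List.Membership.Propositional as List
import Data.List.Membership.DecPropositional as ListDec
open import Data.List.Relation.Binary.Disjoint.Propositional using (Disjoint)
open import Data.List.Relation.Unary.All using ([]; _∷_)
open import Data.List.Relation.Unary.Any using (here; there)
open import Data.List.Relation.Unary.AllPairs using ([]; _∷_)
open import Data.List.Relation.Unary.Unique.Propositional using (Unique)
import Data.List.Relation.Unary.Unique.DecPropositional as UniqueDec
open import Data.Nat.Base using (ℕ; suc; _+_; _*_; _∸_; _⊓_; _≤_; z≤n; s≤s; _≤ᵇ_)
  renaming (_<_ to _<ℕ_)
import Data.Nat.Properties as ℕ
open import Data.Nat.Solver using (module +-*-Solver)
open import Data.Product.Base using (Σ-syntax; ∃; _×_; _,_; proj₁; proj₂)
open import Data.Refinement using (Refinement; Refinement-syntax; _,_)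
open import Data.Sum.Base using (_⊎_; inj₁; inj₂; [_,_]′)
open import Data.Unit.Base using (tt)
open import Data.Vec.Base using ([]; _∷_)
import Data.Vec.Properties as Vec
open import Function.Base using (_∘_; _$_)
open import Function.Bundles using (_↔_; _⇔_; Inverse)
open import Function.Definitions using (Injective)
open import Level using (Level; _⊔_; 0ℓ) renaming (suc to ℓsuc)
open import Relation.Binary.Core using (Rel)
open import Relation.Binary.Definitions using (tri<; tri≈; tri>)
open import Relation.Binary.PropositionalEquality
  using (_≡_; _≢_; refl; sym; trans; cong; cong₂; subst; subst₂; ≢-sym)
open import Relation.Binary.Structures using (IsStrictTotalOrder)
open import Relation.Nullary using (¬_; Dec; yes; no; does; contradiction)
open import Relation.Nullary.Decidable using (¬?; _×-dec_)
import Relation.Unary as Pred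
open Pred using (Pred; Decidable; _≐_)

private
  variable
    k m n : ℕ

------------------------------------------------------------------------
-- Hyperfields

-- x ⊞ y is the subset of the carrier given by a predicate; equality of
-- subsets is _≐_, and the singleton of x is (_≈ x).

record Hyperfield (c ℓ h : Level) : Set (ℓsuc (c ⊔ ℓ ⊔ h)) where
  infix  8 -_
  infixl 7 _⊙_
  infixl 6 _⊞_ _⊞ˢ_
  infix  4 _≈_ _≉_
  field
    Carrier : Set c
    _≈_     : Rel Carrier ℓ
    _⊞_     : Carrier → Carrier → Pred Carrier h
    _⊙_     : Carrier → Carrier → Carrier
    -_      : Carrier → Carrier
    0# 1#   : Carrier

  _≉_ : Rel Carrier ℓ
  x ≉ y = ¬ (x ≈ y)

  _⊞ˢ_ : ∀ {p q} → Pred Carrier p → Pred Carrier q → Pred Carrier _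
  (A ⊞ˢ B) x = ∃ λ a → ∃ λ b → a Pred.∈ A × b Pred.∈ B × x Pred.∈ a ⊞ b

  _⊙ˢ_ : ∀ {p} → Carrier → Pred Carrier p → Pred Carrier _
  (a ⊙ˢ B) x = ∃ λ b → b Pred.∈ B × x ≈ a ⊙ b

  field
    1≉0         : 1# ≉ 0#
    ⊞-resp-≈    : ∀ {x x′ y y′ z z′} → x ≈ x′ → y ≈ y′ → z ≈ z′ →
                  z Pred.∈ x ⊞ y → z′ Pred.∈ x′ ⊞ y′
    ⊞-nonempty  : ∀ x y → Pred.Satisfiable (x ⊞ y)
    ⊞-comm      : ∀ x y → x ⊞ y ≐ y ⊞ x
    ⊞-assoc     : ∀ x y z → (x ⊞ y) ⊞ˢ (_≈ z) ≐ (_≈ x) ⊞ˢ (y ⊞ z)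
    ⊞-identityˡ : ∀ x → 0# ⊞ x ≐ (_≈ x)
    -‿inverseʳ  : ∀ x → 0# Pred.∈ x ⊞ (- x)
    -‿unique    : ∀ x y → 0# Pred.∈ x ⊞ y → y ≈ - x
    reversible  : ∀ x y z → x Pred.∈ y ⊞ z ⇔ z Pred.∈ x ⊞ (- y)
    ⊙-isCommutativeMonoid : IsCommutativeMonoid _≈_ _⊙_ 1#
    ⊙-zeroˡ     : ∀ x → 0# ⊙ x ≈ 0#
    ⊙-distribˡ  : ∀ a x y → a ⊙ˢ (x ⊞ y) ≐ (a ⊙ x) ⊞ (a ⊙ y)
    ⊙-≉0        : ∀ {x y} → x ≉ 0# → y ≉ 0# → x ⊙ y ≉ 0#

  open IsCommutativeMonoid ⊙-isCommutativeMonoid public using (isEquivalence)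

  H* : Set (c ⊔ ℓ)
  H* = ∃ λ x → x ≉ 0#

  infix  8 _⁻¹
  infixl 7 _⊙*_
  infix  4 _≈*_

  _≈*_ : Rel H* ℓ
  x ≈* y = proj₁ x ≈ proj₁ y

  _⊙*_ : H* → H* → H*
  (x , x≉0) ⊙* (y , y≉0) = x ⊙ y , ⊙-≉0 x≉0 y≉0

  1* : H*
  1* = 1# , 1≉0

  field
    _⁻¹        : H* → H*
    H*-isGroup : IsGroup _≈*_ _⊙*_ 1* _⁻¹

  X : Pred (H* × H*) h
  X (u , v) = 1# Pred.∈ proj₁ u ⊞ proj₁ v

------------------------------------------------------------------------
-- Matroids on the ground set Fin n, given by their rank function

record Matroid (n : ℕ) : Set where
  field
    rk            : Subset n → ℕ
    rk-bounded    : ∀ p → rk p ≤ ∣ p ∣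
    rk-mono       : ∀ {p q} → p ⊆ q → rk p ≤ rk q
    rk-submodular : ∀ p q → rk (p ∪ q) + rk (p ∩ q) ≤ rk p + rk q

  Independent : Pred (Subset n) 0ℓ
  Independent p = rk p ≡ ∣ p ∣

  IsCircuit : Pred (Subset n) 0ℓ
  IsCircuit p = ¬ Independent p × (∀ {q} → q ⊂ p → Independent q)

  dim : Subset n → ℤ
  dim p = pos ∣ p ∣ - pos (rk p) - 1ℤ

open Matroid using (rk; rk-bounded; rk-mono; rk-submodular)

image : (Fin m → Fin n) → Subset m → Subset n
image f []            = ⊥
image f (inside  ∷ p) = ⁅ f zero ⁆ ∪ image (f ∘ suc) p
image f (outside ∷ p) = image (f ∘ suc) p

infix 4 _≅_

_≅_ : Matroid m → Matroid n → Set
_≅_ {m} {n} M N =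
  Σ[ f ∈ Fin m ↔ Fin n ] ∀ p → rk N (image (Inverse.to f) p) ≡ rk M p

------------------------------------------------------------------------
-- Cardinalities of subsets

private

  ∪-least : ∀ {p q r : Subset n} → p ⊆ r → q ⊆ r → p ∪ q ⊆ r
  ∪-least {p = p} {q} p⊆r q⊆r x∈p∪q = [ p⊆r , q⊆r ]′ (x∈p∪q⁻ p q x∈p∪q)

  ∪-monoˡ : ∀ {p q} (r : Subset n) → p ⊆ q → p ∪ r ⊆ q ∪ r
  ∪-monoˡ {q = q} r p⊆q = ∪-least (⊆-trans p⊆q (p⊆p∪q r)) (q⊆p∪q q r)

  ∣∪∣+∣∩∣ : ∀ (p q : Subset n) → ∣ p ∪ q ∣ + ∣ p ∩ q ∣ ≡ ∣ p ∣ + ∣ q ∣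
  ∣∪∣+∣∩∣ []            []            = refl
  ∣∪∣+∣∩∣ (outside ∷ p) (outside ∷ q) = ∣∪∣+∣∩∣ p q
  ∣∪∣+∣∩∣ (outside ∷ p) (inside  ∷ q) =
    trans (cong suc (∣∪∣+∣∩∣ p q)) (sym (ℕ.+-suc (∣ p ∣) (∣ q ∣)))
  ∣∪∣+∣∩∣ (inside  ∷ p) (outside ∷ q) = cong suc (∣∪∣+∣∩∣ p q)
  ∣∪∣+∣∩∣ (inside  ∷ p) (inside  ∷ q) =
    cong suc (trans (ℕ.+-suc _ _) (trans (cong suc (∣∪∣+∣∩∣ p q)) (sym (ℕ.+-suc (∣ p ∣) (∣ q ∣)))))

  ∣─∣+∣∣ : ∀ {p q : Subset n} → p ⊆ q → ∣ q ─ p ∣ + ∣ p ∣ ≡ ∣ q ∣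
  ∣─∣+∣∣ {p = []}          {[]}          p⊆q = refl
  ∣─∣+∣∣ {p = outside ∷ p} {outside ∷ q} p⊆q = ∣─∣+∣∣ (drop-∷-⊆ p⊆q)
  ∣─∣+∣∣ {p = outside ∷ p} {inside  ∷ q} p⊆q = cong suc (∣─∣+∣∣ (drop-∷-⊆ p⊆q))
  ∣─∣+∣∣ {p = inside  ∷ p} {outside ∷ q} p⊆q with () ← p⊆q Data.Vec.Base.here
    where import Data.Vec.Base
  ∣─∣+∣∣ {p = inside  ∷ p} {inside  ∷ q} p⊆q =
    trans (ℕ.+-suc _ _) (cong suc (∣─∣+∣∣ (drop-∷-⊆ p⊆q)))

  ∣∪∣≤ : ∀ (p q : Subset n) → ∣ p ∪ q ∣ ≤ ∣ p ∣ + ∣ q ∣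
  ∣∪∣≤ p q = ℕ.≤-trans (ℕ.m≤m+n _ _) (ℕ.≤-reflexive (∣∪∣+∣∩∣ p q))

  ⊆-─ : ∀ (p q : Subset n) → q ⊆ p ∪ (q ─ p)
  ⊆-─ p q {x} x∈q with x ∈? p
  ... | yes x∈p = p⊆p∪q (q ─ p) x∈p
  ... | no  x∉p = q⊆p∪q p (q ─ p) (x∈p∧x∉q⇒x∈p─q x∈q x∉p)

  ⊆∧≢⇒⊂ : ∀ {p q : Subset n} → p ⊆ q → p ≢ q → p ⊂ q
  ⊆∧≢⇒⊂ {p = p} {q} p⊆q p≢q with Fin.any? (λ x → (x ∈? q) ×-dec ¬? (x ∈? p))
  ... | yes ∃x = p⊆q , ∃x
  ... | no ¬∃x = contradiction (⊆-antisym p⊆q q⊆p) p≢q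
    where
    q⊆p : q ⊆ p
    q⊆p {x} x∈q with x ∈? p
    ... | yes x∈p = x∈p
    ... | no  x∉p = contradiction (x , x∈q , x∉p) ¬∃x

  ∣image∣≤ : ∀ (f : Fin m → Fin n) p → ∣ image f p ∣ ≤ ∣ p ∣
  ∣image∣≤ {n = n} f [] = ℕ.≤-reflexive (∣⊥∣≡0 n)
  ∣image∣≤ f (inside  ∷ p) = ℕ.≤-trans (∣∪∣≤ ⁅ f zero ⁆ (image (f ∘ suc) p))
    (ℕ.+-mono-≤ (ℕ.≤-reflexive (∣⁅x⁆∣≡1 (f zero))) (∣image∣≤ (f ∘ suc) p))
  ∣image∣≤ f (outside ∷ p) = ∣image∣≤ (f ∘ suc) p

  image-mono : ∀ (f : Fin m → Fin n) {p q} → p ⊆ q → image f p ⊆ image f q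
  image-mono f {[]}          {[]}          p⊆q = ⊆-refl
  image-mono f {outside ∷ p} {outside ∷ q} p⊆q = image-mono (f ∘ suc) (drop-∷-⊆ p⊆q)
  image-mono f {outside ∷ p} {inside  ∷ q} p⊆q =
    ⊆-trans (image-mono (f ∘ suc) (drop-∷-⊆ p⊆q)) (q⊆p∪q ⁅ f zero ⁆ _)
  image-mono f {inside  ∷ p} {outside ∷ q} p⊆q with () ← p⊆q Data.Vec.Base.here
    where import Data.Vec.Base
  image-mono f {inside  ∷ p} {inside  ∷ q} p⊆q =
    ∪-least (p⊆p∪q _) (⊆-trans (image-mono (f ∘ suc) (drop-∷-⊆ p⊆q)) (q⊆p∪q ⁅ f zero ⁆ _))

  image-∪ : ∀ (f : Fin m → Fin n) p q → image f (p ∪ q) ⊆ image f p ∪ image f q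
  image-∪ f []            []            = ⊥⊆
  image-∪ f (outside ∷ p) (outside ∷ q) = image-∪ (f ∘ suc) p q
  image-∪ f (outside ∷ p) (inside  ∷ q) = ∪-least
    (⊆-trans (p⊆p∪q _) (q⊆p∪q (image (f ∘ suc) p) _))
    (⊆-trans (image-∪ (f ∘ suc) p q) (∪-least (p⊆p∪q _)
      (⊆-trans (q⊆p∪q ⁅ f zero ⁆ _) (q⊆p∪q (image (f ∘ suc) p) _))))
  image-∪ f (inside  ∷ p) (outside ∷ q) = ∪-least
    (⊆-trans (p⊆p∪q _) (p⊆p∪q _))
    (⊆-trans (image-∪ (f ∘ suc) p q)
      (∪-monoˡ (image (f ∘ suc) q) (q⊆p∪q ⁅ f zero ⁆ _)))
  image-∪ f (inside  ∷ p) (inside  ∷ q) = ∪-least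
    (⊆-trans (p⊆p∪q _) (p⊆p∪q _))
    (⊆-trans (image-∪ (f ∘ suc) p q) (∪-least
      (⊆-trans (q⊆p∪q ⁅ f zero ⁆ _) (p⊆p∪q _))
      (⊆-trans (q⊆p∪q ⁅ f zero ⁆ _) (q⊆p∪q (⁅ f zero ⁆ ∪ image (f ∘ suc) p) _))))

  ∸-submodular : ∀ {a b c d} r → r ≤ a → r ≤ b → r ≤ c → r ≤ d →
                 a + b ≤ c + d → (a ∸ r) + (b ∸ r) ≤ (c ∸ r) + (d ∸ r)
  ∸-submodular {a} {b} {c} {d} r r≤a r≤b r≤c r≤d a+b≤c+d =
    ℕ.+-cancelʳ-≤ (r + r) _ _ (begin
      (a ∸ r) + (b ∸ r) + (r + r)   ≡⟨ shuffle (a ∸ r) (b ∸ r) ⟩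
      (a ∸ r + r) + (b ∸ r + r)     ≡⟨ cong₂ _+_ (ℕ.m∸n+n≡m r≤a) (ℕ.m∸n+n≡m r≤b) ⟩
      a + b                         ≤⟨ a+b≤c+d ⟩
      c + d                         ≡⟨ cong₂ _+_ (ℕ.m∸n+n≡m r≤c) (ℕ.m∸n+n≡m r≤d) ⟨
      (c ∸ r + r) + (d ∸ r + r)     ≡⟨ shuffle (c ∸ r) (d ∸ r) ⟨
      (c ∸ r) + (d ∸ r) + (r + r)   ∎)
    where
    open ℕ.≤-Reasoning
    shuffle : ∀ x y → x + y + (r + r) ≡ (x + r) + (y + r)
    shuffle x y = solve 3 (λ x y r → x :+ y :+ (r :+ r) := (x :+ r) :+ (y :+ r)) refl x y r
      where open +-*-Solver

module _ (M : Matroid n) where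

  rk-subadditive : ∀ p q → rk M (p ∪ q) ≤ rk M p + rk M q
  rk-subadditive p q = ℕ.≤-trans (ℕ.m≤m+n _ _) (rk-submodular M p q)

  rk-growth : ∀ {p q} → p ⊆ q → rk M q + ∣ p ∣ ≤ rk M p + ∣ q ∣
  rk-growth {p} {q} p⊆q = begin
    rk M q + ∣ p ∣                   ≤⟨ ℕ.+-monoˡ-≤ ∣ p ∣ (rk-mono M (⊆-─ p q)) ⟩
    rk M (p ∪ (q ─ p)) + ∣ p ∣       ≤⟨ ℕ.+-monoˡ-≤ ∣ p ∣ (rk-subadditive p (q ─ p)) ⟩
    rk M p + rk M (q ─ p) + ∣ p ∣    ≤⟨ ℕ.+-monoˡ-≤ ∣ p ∣ (ℕ.+-monoʳ-≤ (rk M p) (rk-bounded M _)) ⟩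
    rk M p + ∣ q ─ p ∣ + ∣ p ∣       ≡⟨ ℕ.+-assoc (rk M p) _ _ ⟩
    rk M p + (∣ q ─ p ∣ + ∣ p ∣)     ≡⟨ cong (rk M p +_) (∣─∣+∣∣ p⊆q) ⟩
    rk M p + ∣ q ∣                   ∎
    where open ℕ.≤-Reasoning

------------------------------------------------------------------------
-- Duality and minors

dual : Matroid n → Matroid n
dual {n} M = record
  { rk            = λ p → corank p ∸ rk M ⊤
  ; rk-bounded    = λ p → ℕ.m≤n+o⇒m∸n≤o (corank p) (rk M ⊤) (begin
      ∣ p ∣ + rk M (∁ p)  ≤⟨ ℕ.+-monoʳ-≤ ∣ p ∣ (rk-mono M (⊆-max (∁ p))) ⟩
      ∣ p ∣ + rk M ⊤      ≡⟨ ℕ.+-comm ∣ p ∣ _ ⟩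
      rk M ⊤ + ∣ p ∣      ∎)
  ; rk-mono       = λ p⊆q → ℕ.∸-monoˡ-≤ (rk M ⊤) (corank-mono p⊆q)
  ; rk-submodular = λ p q → ∸-submodular (rk M ⊤)
      (bound (p ∪ q)) (bound (p ∩ q)) (bound p) (bound q) (begin
        (∣ p ∪ q ∣ + rk M (∁ (p ∪ q))) + (∣ p ∩ q ∣ + rk M (∁ (p ∩ q)))
          ≡⟨ interchange (∣ p ∪ q ∣) _ (∣ p ∩ q ∣) _ ⟩
        (∣ p ∪ q ∣ + ∣ p ∩ q ∣) + (rk M (∁ (p ∪ q)) + rk M (∁ (p ∩ q)))
          ≡⟨ cong₂ _+_ (∣∪∣+∣∩∣ p q) (ℕ.+-comm (rk M (∁ (p ∪ q))) _) ⟩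
        (∣ p ∣ + ∣ q ∣) + (rk M (∁ (p ∩ q)) + rk M (∁ (p ∪ q)))
          ≤⟨ ℕ.+-monoʳ-≤ (∣ p ∣ + ∣ q ∣) (ℕ.+-mono-≤ (rk-mono M (∁∩⊆ p q)) (rk-mono M (∁∪⊆ p q))) ⟩
        (∣ p ∣ + ∣ q ∣) + (rk M (∁ p ∪ ∁ q) + rk M (∁ p ∩ ∁ q))
          ≤⟨ ℕ.+-monoʳ-≤ (∣ p ∣ + ∣ q ∣) (rk-submodular M (∁ p) (∁ q)) ⟩
        (∣ p ∣ + ∣ q ∣) + (rk M (∁ p) + rk M (∁ q))
          ≡⟨ interchange (∣ p ∣) (∣ q ∣) _ _ ⟩
        (∣ p ∣ + rk M (∁ p)) + (∣ q ∣ + rk M (∁ q)) ∎)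
  }
  where
  open ℕ.≤-Reasoning
  corank : Subset n → ℕ
  corank p = ∣ p ∣ + rk M (∁ p)
  interchange : ∀ a b c d → (a + b) + (c + d) ≡ (a + c) + (b + d)
  interchange = solve 4 (λ a b c d → (a :+ b) :+ (c :+ d) := (a :+ c) :+ (b :+ d)) refl
    where open +-*-Solver
  corank-mono : ∀ {p q} → p ⊆ q → corank p ≤ corank q
  corank-mono {p} {q} p⊆q = ℕ.+-cancelʳ-≤ ∣ ∁ q ∣ _ _ (begin
    (∣ p ∣ + rk M (∁ p)) + ∣ ∁ q ∣   ≡⟨ ℕ.+-assoc ∣ p ∣ _ _ ⟩
    ∣ p ∣ + (rk M (∁ p) + ∣ ∁ q ∣)   ≤⟨ ℕ.+-monoʳ-≤ ∣ p ∣ (rk-growth M (p⊆q⇒∁p⊇∁q p⊆q)) ⟩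
    ∣ p ∣ + (rk M (∁ q) + ∣ ∁ p ∣)   ≡⟨ ℕ.+-assoc ∣ p ∣ _ _ ⟨
    (∣ p ∣ + rk M (∁ q)) + ∣ ∁ p ∣   ≡⟨ swap ∣ p ∣ _ _ ⟩
    (∣ p ∣ + ∣ ∁ p ∣) + rk M (∁ q)   ≡⟨ cong (_+ rk M (∁ q)) (trans (∣∣+∣∁∣ p) (sym (∣∣+∣∁∣ q))) ⟩
    (∣ q ∣ + ∣ ∁ q ∣) + rk M (∁ q)   ≡⟨ swap ∣ q ∣ _ _ ⟨
    (∣ q ∣ + rk M (∁ q)) + ∣ ∁ q ∣   ∎)
    where
    swap : ∀ a b c → (a + b) + c ≡ (a + c) + b
    swap = solve 3 (λ a b c → (a :+ b) :+ c := (a :+ c) :+ b) refl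
      where open +-*-Solver
    ∣∣+∣∁∣ : ∀ p → ∣ p ∣ + ∣ ∁ p ∣ ≡ n
    ∣∣+∣∁∣ p = trans (cong (∣ p ∣ +_) (∣∁p∣≡n∸∣p∣ p)) (ℕ.m+[n∸m]≡n (∣p∣≤n p))
  bound : ∀ p → rk M ⊤ ≤ corank p
  bound p = begin
    rk M ⊤                ≡⟨ cong (rk M) (p∪∁p≡⊤ p) ⟨
    rk M (p ∪ ∁ p)        ≤⟨ rk-subadditive M p (∁ p) ⟩
    rk M p + rk M (∁ p)   ≤⟨ ℕ.+-monoˡ-≤ _ (rk-bounded M p) ⟩
    ∣ p ∣ + rk M (∁ p)    ∎
  ∁∩⊆ : ∀ p q → ∁ (p ∩ q) ⊆ ∁ p ∪ ∁ q
  ∁∩⊆ p q {x} x∈ with x ∈? p | x ∈? q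
  ... | yes x∈p | yes x∈q = contradiction (x∈p∩q⁺ (x∈p , x∈q)) (x∈∁p⇒x∉p x∈)
  ... | no  x∉p | _       = p⊆p∪q (∁ q) (x∉p⇒x∈∁p x∉p)
  ... | yes _   | no x∉q  = q⊆p∪q (∁ p) (∁ q) (x∉p⇒x∈∁p x∉q)
  ∁∪⊆ : ∀ p q → ∁ (p ∪ q) ⊆ ∁ p ∩ ∁ q
  ∁∪⊆ p q x∈ = x∈p∩q⁺
    ( x∉p⇒x∈∁p (λ x∈p → x∈∁p⇒x∉p x∈ (p⊆p∪q q x∈p))
    , x∉p⇒x∈∁p (λ x∈q → x∈∁p⇒x∉p x∈ (q⊆p∪q p q x∈q)))

-- Contract t, then restrict to the range of f and relabel it along f.
-- This is a minor of M when f is injective with range disjoint from t;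
-- the deleted elements are those outside both t and the range of f.
minor : Matroid n → (t : Subset n) → (Fin k → Fin n) → Matroid k
minor {n} {k} M t f = record
  { rk            = λ p → r p ∸ rk M t
  ; rk-bounded    = λ p → ℕ.m≤n+o⇒m∸n≤o (r p) (rk M t) (begin
      rk M (image f p ∪ t)      ≤⟨ rk-subadditive M (image f p) t ⟩
      rk M (image f p) + rk M t ≤⟨ ℕ.+-monoˡ-≤ (rk M t) (ℕ.≤-trans (rk-bounded M _) (∣image∣≤ f p)) ⟩
      ∣ p ∣ + rk M t            ≡⟨ ℕ.+-comm ∣ p ∣ _ ⟩
      rk M t + ∣ p ∣            ∎)
  ; rk-mono       = λ p⊆q → ℕ.∸-monoˡ-≤ (rk M t) (rk-mono M (∪-monoˡ t (image-mono f p⊆q)))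
  ; rk-submodular = λ p q → ∸-submodular (rk M t)
      (bound (p ∪ q)) (bound (p ∩ q)) (bound p) (bound q) (begin
        r (p ∪ q) + r (p ∩ q)
          ≤⟨ ℕ.+-mono-≤ (rk-mono M (∪⊆ p q)) (rk-mono M (∩⊆ p q)) ⟩
        rk M ((image f p ∪ t) ∪ (image f q ∪ t)) + rk M ((image f p ∪ t) ∩ (image f q ∪ t))
          ≤⟨ rk-submodular M _ _ ⟩
        r p + r q ∎)
  }
  where
  open ℕ.≤-Reasoning
  r : Subset k → ℕ
  r p = rk M (image f p ∪ t)
  bound : ∀ p → rk M t ≤ r p
  bound p = rk-mono M (q⊆p∪q (image f p) t)
  ∪⊆ : ∀ p q → image f (p ∪ q) ∪ t ⊆ (image f p ∪ t) ∪ (image f q ∪ t)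
  ∪⊆ p q = ∪-least
    (⊆-trans (image-∪ f p q)
      (∪-least (⊆-trans (p⊆p∪q t) (p⊆p∪q _))
               (⊆-trans (p⊆p∪q t) (q⊆p∪q (image f p ∪ t) _))))
    (⊆-trans (q⊆p∪q (image f p) t) (p⊆p∪q _))
  ∩⊆ : ∀ p q → image f (p ∩ q) ∪ t ⊆ (image f p ∪ t) ∩ (image f q ∪ t)
  ∩⊆ p q x∈ = x∈p∩q⁺
    ( ∪-monoˡ t (image-mono f (p∩q⊆p p q)) x∈
    , ∪-monoˡ t (image-mono f (p∩q⊆q p q)) x∈)

HasMinor : Matroid n → Matroid m → Set
HasMinor {n} M N =
  Σ[ k ∈ ℕ ] Σ[ t ∈ Subset n ] Σ[ f ∈ (Fin k → Fin n) ]
    Injective _≡_ _≡_ f × (∀ i → f i ∉ t) × minor M t f ≅ N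

------------------------------------------------------------------------
-- The Fano matroid

fanoLines : List (Subset 7)
fanoLines =
  (⁅ 0F ⁆ ∪ ⁅ 1F ⁆ ∪ ⁅ 3F ⁆) ∷
  (⁅ 1F ⁆ ∪ ⁅ 2F ⁆ ∪ ⁅ 4F ⁆) ∷
  (⁅ 2F ⁆ ∪ ⁅ 3F ⁆ ∪ ⁅ 5F ⁆) ∷
  (⁅ 3F ⁆ ∪ ⁅ 4F ⁆ ∪ ⁅ 6F ⁆) ∷
  (⁅ 4F ⁆ ∪ ⁅ 5F ⁆ ∪ ⁅ 0F ⁆) ∷
  (⁅ 5F ⁆ ∪ ⁅ 6F ⁆ ∪ ⁅ 1F ⁆) ∷
  (⁅ 6F ⁆ ∪ ⁅ 0F ⁆ ∪ ⁅ 2F ⁆) ∷ []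

fanoRank : Subset 7 → ℕ
fanoRank p = if does (p ∈L? fanoLines) then 2 else ∣ p ∣ ⊓ 3
  where open ListDec (Vec.≡-dec Bool._≟_) renaming (_∈?_ to _∈L?_)

private

  -- fanoRank is tabulated once so that the matroid axioms can be checked
  -- by evaluation in reasonable time.

  data Table : ℕ → Set where
    leaf : ℕ → Table 0
    node : Table n → Table n → Table (suc n)

  tabulate : (Subset n → ℕ) → Table n
  tabulate {ℕ.zero} f = leaf (f [])
  tabulate {suc n}  f = node (tabulate (f ∘ (inside ∷_))) (tabulate (f ∘ (outside ∷_)))

  look : Table n → Subset n → ℕ
  look (leaf x)   []            = x
  look (node l r) (inside  ∷ p) = look l p
  look (node l r) (outside ∷ p) = look r p

  look-tabulate : ∀ (f : Subset n → ℕ) p → look (tabulate f) p ≡ f p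
  look-tabulate f []            = refl
  look-tabulate f (inside  ∷ p) = look-tabulate (f ∘ (inside ∷_)) p
  look-tabulate f (outside ∷ p) = look-tabulate (f ∘ (outside ∷_)) p

  allSubsets : (Subset n → Bool) → Bool
  allSubsets {ℕ.zero} P = P []
  allSubsets {suc n}  P = allSubsets (P ∘ (inside ∷_)) ∧ allSubsets (P ∘ (outside ∷_))

  ∧-true : ∀ {x y} → x ∧ y ≡ true → x ≡ true × y ≡ true
  ∧-true {true} {true} _ = refl , refl

  allSubsets-sound : (P : Subset n → Bool) → allSubsets P ≡ true → ∀ p → P p ≡ true
  allSubsets-sound P h []            = h
  allSubsets-sound P h (inside  ∷ p) =
    allSubsets-sound (P ∘ (inside ∷_)) (proj₁ (∧-true h)) p
  allSubsets-sound P h (outside ∷ p) =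
    allSubsets-sound (P ∘ (outside ∷_))
      (proj₂ (∧-true {allSubsets (P ∘ (inside ∷_))} h)) p

  boundedᵇ monoᵇ submodularᵇ : Table n → Bool
  boundedᵇ t    = allSubsets λ p → look t p ≤ᵇ ∣ p ∣
  monoᵇ t       = allSubsets λ p → allSubsets λ q → look t p ≤ᵇ look t (p ∪ q)
  submodularᵇ t = allSubsets λ p → allSubsets λ q →
    look t (p ∪ q) + look t (p ∩ q) ≤ᵇ look t p + look t q

  ≤ᵇ-true : ∀ {x y} → (x ≤ᵇ y) ≡ true → x ≤ y
  ≤ᵇ-true {x} {y} eq = ℕ.≤ᵇ⇒≤ x y (subst T (sym eq) tt)

  module _ (f : Subset n → ℕ) where

    bounded : boundedᵇ (tabulate f) ≡ true → ∀ p → f p ≤ ∣ p ∣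
    bounded h p = subst (_≤ ∣ p ∣) (look-tabulate f p)
      (≤ᵇ-true (allSubsets-sound _ h p))

    mono : monoᵇ (tabulate f) ≡ true → ∀ {p q} → p ⊆ q → f p ≤ f q
    mono h {p} {q} p⊆q = subst (λ s → f p ≤ f s)
      (⊆-antisym (∪-least p⊆q ⊆-refl) (q⊆p∪q p q))
      (subst₂ _≤_ (look-tabulate f p) (look-tabulate f (p ∪ q))
        (≤ᵇ-true (allSubsets-sound _ (allSubsets-sound _ h p) q)))

    submodular : submodularᵇ (tabulate f) ≡ true →
                 ∀ p q → f (p ∪ q) + f (p ∩ q) ≤ f p + f q
    submodular h p q = subst₂ _≤_
      (cong₂ _+_ (look-tabulate f (p ∪ q)) (look-tabulate f (p ∩ q)))
      (cong₂ _+_ (look-tabulate f p) (look-tabulate f q))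
      (≤ᵇ-true (allSubsets-sound _ (allSubsets-sound _ h p) q))

  fano-bounded : boundedᵇ (tabulate fanoRank) ≡ true
  fano-bounded = refl

  fano-mono : monoᵇ (tabulate fanoRank) ≡ true
  fano-mono = refl

  fano-submodular : submodularᵇ (tabulate fanoRank) ≡ true
  fano-submodular = refl

Fano : Matroid 7
Fano = record
  { rk            = fanoRank
  ; rk-bounded    = bounded fanoRank fano-bounded
  ; rk-mono       = mono fanoRank fano-mono
  ; rk-submodular = submodular fanoRank fano-submodular
  }

------------------------------------------------------------------------
-- Totally ordered enumerations of the circuits

record CircuitEnumeration (M : Matroid n) : Set₁ where
  open Matroid M using (IsCircuit; dim)
  infix 4 _<_ _≥_
  field
    size               : ℕ
    C                  : Fin size → Subset n
    C-injective        : Injective _≡_ _≡_ C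
    C-isCircuit        : ∀ j → IsCircuit (C j)
    C-complete         : ∀ {p} → IsCircuit p → ∃ λ j → C j ≡ p
    _<_                : Rel (Fin size) 0ℓ
    isStrictTotalOrder : IsStrictTotalOrder _≡_ _<_

  open IsStrictTotalOrder isStrictTotalOrder public using (compare; _<?_)

  J : Set
  J = Fin size

  _≥_ : Rel J 0ℓ
  i ≥ j = j < i ⊎ j ≡ i

  Quad : Set
  Quad = J × J × J × J

  dim₄ : J → J → J → J → ℤ
  dim₄ a b c e = dim (C a ∪ C b ∪ C c ∪ C e)

  InK : Pred Quad 0ℓ
  InK (j₁ , j₂ , j₃ , j₄) =
    Unique (j₁ ∷ j₂ ∷ j₃ ∷ j₄ ∷ []) × dim₄ j₁ j₂ j₃ j₄ ≡ 1ℤ ×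
    j₁ < j₂ × j₃ < j₄ × j₁ < j₃

  InN : Pred Quad 0ℓ
  InN (j₁ , j₂ , j₃ , j₄) =
    dim₄ j₁ j₂ j₃ j₄ ≡ 1ℤ × j₁ < j₂ × j₂ < j₃ × j₃ < j₄

  -- The membership proofs are irrelevant, so elements of K with the same
  -- underlying quadruple are equal.
  K : Set
  K = [ q ∈ Quad ∣ InK q ]

  InK? : Decidable InK
  InK? (j₁ , j₂ , j₃ , j₄) =
    unique? (j₁ ∷ j₂ ∷ j₃ ∷ j₄ ∷ []) ×-dec (dim₄ j₁ j₂ j₃ j₄ ℤ.≟ 1ℤ) ×-dec
    (j₁ <? j₂) ×-dec (j₃ <? j₄) ×-dec (j₁ <? j₃)
    where open UniqueDec (Fin._≟_ {size}) using (unique?)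

  InN? : Decidable InN
  InN? (j₁ , j₂ , j₃ , j₄) =
    (dim₄ j₁ j₂ j₃ j₄ ℤ.≟ 1ℤ) ×-dec (j₁ <? j₂) ×-dec (j₂ <? j₃) ×-dec (j₃ <? j₄)

  allQuads : List Quad
  allQuads = cartesianProduct js (cartesianProduct js (cartesianProduct js js))
    where js = allFin size

  kM : ℕ
  kM = length (filter InK? allQuads)

  nM : ℕ
  nM = length (filter InN? allQuads)

------------------------------------------------------------------------
-- Any union of circuits, two of them distinct, inside a union of
-- circuits of dimension 1 has dimension 1 itself.

module _ (M : Matroid n) where

  open Matroid M using (Independent; IsCircuit; dim)

  dim≡1⇒∣∣ : ∀ {p} → dim p ≡ 1ℤ → ∣ p ∣ ≡ 2 + rk M p
  dim≡1⇒∣∣ {p} eq = ℤ.+-injective (trans (solve 2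
      (λ a b → a := (a :- b :- con 1ℤ) :+ (con 1ℤ :+ b)) refl (pos ∣ p ∣) (pos (rk M p)))
      (cong (_+ℤ pos (suc (rk M p))) eq))
    where open ℤSolver.+-*-Solver

  ∣∣⇒dim≡1 : ∀ {p} → ∣ p ∣ ≡ 2 + rk M p → dim p ≡ 1ℤ
  ∣∣⇒dim≡1 {p} eq rewrite eq =
    solve 1 (λ b → (con 1ℤ :+ (con 1ℤ :+ b)) :- b :- con 1ℤ := con 1ℤ) refl (pos (rk M p))
    where open ℤSolver.+-*-Solver

  circuits-nullity : ∀ {p q} → IsCircuit p → IsCircuit q → p ≢ q →
                     2 + rk M (p ∪ q) ≤ ∣ p ∪ q ∣
  circuits-nullity {p} {q} (p-dep , p-min) (q-dep , q-min) p≢q =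
    ℕ.+-cancelʳ-≤ ∣ p ∩ q ∣ _ _ (begin
      2 + rk M (p ∪ q) + ∣ p ∩ q ∣           ≡⟨ cong (λ r → 2 + rk M (p ∪ q) + r) (p-min p∩q⊂p) ⟨
      2 + (rk M (p ∪ q) + rk M (p ∩ q))      ≤⟨ s≤s (s≤s (rk-submodular M p q)) ⟩
      2 + (rk M p + rk M q)                  ≡⟨ cong suc (ℕ.+-suc (rk M p) (rk M q)) ⟨
      suc (rk M p) + suc (rk M q)            ≤⟨ ℕ.+-mono-≤ (dep p-dep) (dep q-dep) ⟩
      ∣ p ∣ + ∣ q ∣                          ≡⟨ ∣∪∣+∣∩∣ p q ⟨
      ∣ p ∪ q ∣ + ∣ p ∩ q ∣                  ∎)
    where
    open ℕ.≤-Reasoning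
    dep : ∀ {p} → ¬ Independent p → rk M p <ℕ ∣ p ∣
    dep {p} d = ℕ.≤∧≢⇒< (rk-bounded M p) d
    p∩q⊂p : p ∩ q ⊂ p
    p∩q⊂p = ⊆∧≢⇒⊂ (p∩q⊆p p q) λ p∩q≡p → p-dep $ q-min $ ⊆∧≢⇒⊂
      (⊆-trans (⊆-reflexive (sym p∩q≡p)) (p∩q⊆q p q)) p≢q

  dim≡1-within : ∀ {p q r s} → IsCircuit p → IsCircuit q → p ≢ q →
                 p ∪ q ⊆ r → r ⊆ s → dim s ≡ 1ℤ → dim r ≡ 1ℤ
  dim≡1-within {p} {q} {r} {s} p-circ q-circ p≢q p∪q⊆r r⊆s dim-s =
    ∣∣⇒dim≡1 (ℕ.≤-antisym upper lower)
    where
    open ℕ.≤-Reasoning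
    lower : 2 + rk M r ≤ ∣ r ∣
    lower = ℕ.+-cancelʳ-≤ ∣ p ∪ q ∣ _ _ (begin
      2 + rk M r + ∣ p ∪ q ∣         ≤⟨ s≤s (s≤s (rk-growth M p∪q⊆r)) ⟩
      2 + (rk M (p ∪ q) + ∣ r ∣)     ≤⟨ ℕ.+-monoˡ-≤ ∣ r ∣ (circuits-nullity p-circ q-circ p≢q) ⟩
      ∣ p ∪ q ∣ + ∣ r ∣              ≡⟨ ℕ.+-comm ∣ p ∪ q ∣ _ ⟩
      ∣ r ∣ + ∣ p ∪ q ∣              ∎)
    upper : ∣ r ∣ ≤ 2 + rk M r
    upper = ℕ.+-cancelʳ-≤ (rk M s) _ _ (begin
      ∣ r ∣ + rk M s                 ≡⟨ ℕ.+-comm ∣ r ∣ _ ⟩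
      rk M s + ∣ r ∣                 ≤⟨ rk-growth M r⊆s ⟩
      rk M r + ∣ s ∣                 ≡⟨ cong (rk M r +_) (dim≡1⇒∣∣ dim-s) ⟩
      rk M r + (2 + rk M s)          ≡⟨ ℕ.+-assoc (rk M r) 2 (rk M s) ⟨
      (rk M r + 2) + rk M s          ≡⟨ cong (_+ rk M s) (ℕ.+-comm (rk M r) 2) ⟩
      2 + rk M r + rk M s            ∎)

------------------------------------------------------------------------
-- Cross-ratios

private

  module _ {a} {A : Set a} where

    ∈₁ : ∀ {x : A} {xs} → x List.∈ x ∷ xs
    ∈₁ = here refl
    ∈₂ : ∀ {x y : A} {xs} → y List.∈ x ∷ y ∷ xs
    ∈₂ = there ∈₁
    ∈₃ : ∀ {x y z : A} {xs} → z List.∈ x ∷ y ∷ z ∷ xs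
    ∈₃ = there ∈₂
    ∈₄ : ∀ {x y z w : A} {xs} → w List.∈ x ∷ y ∷ z ∷ w ∷ xs
    ∈₄ = there ∈₃
    ∈₅ : ∀ {x y z w v : A} {xs} → v List.∈ x ∷ y ∷ z ∷ w ∷ v ∷ xs
    ∈₅ = there ∈₄
    ∈₆ : ∀ {x y z w v u : A} {xs} → u List.∈ x ∷ y ∷ z ∷ w ∷ v ∷ u ∷ xs
    ∈₆ = there ∈₅

module Configurations {n} {M : Matroid n} (𝓒 : CircuitEnumeration M) where

  open Matroid M using (dim)
  open CircuitEnumeration 𝓒
  open IsStrictTotalOrder isStrictTotalOrder
    using () renaming (irrefl to <-irrefl; trans to <-trans)

  <⇒≢ : ∀ {i j} → i < j → i ≢ j
  <⇒≢ i<j i≡j = <-irrefl i≡j i<j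

  ∪₄-least : ∀ {p q r s t : Subset n} → p ⊆ t → q ⊆ t → r ⊆ t → s ⊆ t →
             p ∪ q ∪ r ∪ s ⊆ t
  ∪₄-least p⊆t q⊆t r⊆t s⊆t = ∪-least p⊆t (∪-least q⊆t (∪-least r⊆t s⊆t))

  module ∪₄ (p q r s : Subset n) where
    i₁ : p ⊆ p ∪ q ∪ r ∪ s
    i₁ = p⊆p∪q _
    i₂ : q ⊆ p ∪ q ∪ r ∪ s
    i₂ = ⊆-trans (p⊆p∪q _) (q⊆p∪q p _)
    i₃ : r ⊆ p ∪ q ∪ r ∪ s
    i₃ = ⊆-trans (⊆-trans (p⊆p∪q _) (q⊆p∪q q _)) (q⊆p∪q p _)
    i₄ : s ⊆ p ∪ q ∪ r ∪ s
    i₄ = ⊆-trans (⊆-trans (q⊆p∪q r s) (q⊆p∪q q _)) (q⊆p∪q p _)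

  dim₄-within : ∀ {a b c e F} → a ≢ b → C a ⊆ F → C b ⊆ F → C c ⊆ F → C e ⊆ F →
                dim F ≡ 1ℤ → dim₄ a b c e ≡ 1ℤ
  dim₄-within {a} {b} {c} {e} a≢b a⊆F b⊆F c⊆F e⊆F =
    dim≡1-within M (C-isCircuit a) (C-isCircuit b) (a≢b ∘ C-injective)
      (∪-least i₁ i₂) (∪₄-least a⊆F b⊆F c⊆F e⊆F)
    where open ∪₄ (C a) (C b) (C c) (C e)

  dim₄-swap₁ : ∀ {a b c e} → dim₄ a b c e ≡ 1ℤ → dim₄ b a c e ≡ 1ℤ
  dim₄-swap₁ {a} {b} {c} {e} = trans (cong dim (⊆-antisym
    (∪₄-least B.i₂ B.i₁ B.i₃ B.i₄) (∪₄-least A.i₂ A.i₁ A.i₃ A.i₄)))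
    where module A = ∪₄ (C b) (C a) (C c) (C e)
          module B = ∪₄ (C a) (C b) (C c) (C e)

  dim₄-swap₂ : ∀ {a b c e} → dim₄ a b c e ≡ 1ℤ → dim₄ a b e c ≡ 1ℤ
  dim₄-swap₂ {a} {b} {c} {e} = trans (cong dim (⊆-antisym
    (∪₄-least B.i₁ B.i₂ B.i₄ B.i₃) (∪₄-least A.i₁ A.i₂ A.i₄ A.i₃)))
    where module A = ∪₄ (C a) (C b) (C e) (C c)
          module B = ∪₄ (C a) (C b) (C c) (C e)

  dim₄-exchange : ∀ {a b c e} → dim₄ a b c e ≡ 1ℤ → dim₄ c e a b ≡ 1ℤ
  dim₄-exchange {a} {b} {c} {e} = trans (cong dim (⊆-antisym
    (∪₄-least B.i₃ B.i₄ B.i₁ B.i₂) (∪₄-least A.i₃ A.i₄ A.i₁ A.i₂)))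
    where module A = ∪₄ (C c) (C e) (C a) (C b)
          module B = ∪₄ (C a) (C b) (C c) (C e)

  dim₄-middle : ∀ {a b c e} → dim₄ a b c e ≡ 1ℤ → dim₄ a c b e ≡ 1ℤ
  dim₄-middle {a} {b} {c} {e} = trans (cong dim (⊆-antisym
    (∪₄-least B.i₁ B.i₃ B.i₂ B.i₄) (∪₄-least A.i₁ A.i₃ A.i₂ A.i₄)))
    where module A = ∪₄ (C a) (C c) (C b) (C e)
          module B = ∪₄ (C a) (C b) (C c) (C e)

  Disjoint₂ : J → J → J → J → Set
  Disjoint₂ a b c e = Disjoint (a ∷ b ∷ []) (c ∷ e ∷ [])

  disjoint₂ : ∀ {a b c e} → a ≢ c → a ≢ e → b ≢ c → b ≢ e → Disjoint₂ a b c e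
  disjoint₂ a≢c a≢e b≢c b≢e (here refl         , here v≡c)          = a≢c v≡c
  disjoint₂ a≢c a≢e b≢c b≢e (here refl         , there (here v≡e))  = a≢e v≡e
  disjoint₂ a≢c a≢e b≢c b≢e (there (here refl) , here v≡c)          = b≢c v≡c
  disjoint₂ a≢c a≢e b≢c b≢e (there (here refl) , there (here v≡e))  = b≢e v≡e

  disjoint₂-swap₁ : ∀ {a b c e} → Disjoint₂ a b c e → Disjoint₂ b a c e
  disjoint₂-swap₁ d = disjoint₂
    (λ { refl → d (∈₂ , ∈₁) }) (λ { refl → d (∈₂ , ∈₂) })
    (λ { refl → d (∈₁ , ∈₁) }) (λ { refl → d (∈₁ , ∈₂) })

  disjoint₂-swap₂ : ∀ {a b c e} → Disjoint₂ a b c e → Disjoint₂ a b e c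
  disjoint₂-swap₂ d = disjoint₂
    (λ { refl → d (∈₁ , ∈₂) }) (λ { refl → d (∈₁ , ∈₁) })
    (λ { refl → d (∈₂ , ∈₂) }) (λ { refl → d (∈₂ , ∈₁) })

  disjoint₂-exchange : ∀ {a b c e} → Disjoint₂ a b c e → Disjoint₂ c e a b
  disjoint₂-exchange d (x , y) = d (y , x)

  inK : ∀ {p q r s} → Disjoint₂ p q r s → dim₄ p q r s ≡ 1ℤ →
        p < q → r < s → p < r → InK (p , q , r , s)
  inK d dim≡1 p<q r<s p<r =
      ( (<⇒≢ p<q ∷ <⇒≢ p<r ∷ (λ { refl → d (∈₁ , ∈₂) }) ∷ [])
      ∷ ((λ { refl → d (∈₂ , ∈₁) }) ∷ (λ { refl → d (∈₂ , ∈₂) }) ∷ [])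
      ∷ (<⇒≢ r<s ∷ [])
      ∷ [] ∷ [])
    , dim≡1 , p<q , r<s , p<r

  inK-12∣34 : ∀ {j₁ j₂ j₃ j₄} → InN (j₁ , j₂ , j₃ , j₄) → InK (j₁ , j₂ , j₃ , j₄)
  inK-12∣34 (d , l₁ , l₂ , l₃) = inK
    (disjoint₂ (<⇒≢ (<-trans l₁ l₂)) (<⇒≢ (<-trans (<-trans l₁ l₂) l₃))
               (<⇒≢ l₂) (<⇒≢ (<-trans l₂ l₃)))
    d l₁ l₃ (<-trans l₁ l₂)

  inK-13∣24 : ∀ {j₁ j₂ j₃ j₄} → InN (j₁ , j₂ , j₃ , j₄) → InK (j₁ , j₃ , j₂ , j₄)
  inK-13∣24 (d , l₁ , l₂ , l₃) = inK
    (disjoint₂ (<⇒≢ l₁) (<⇒≢ (<-trans (<-trans l₁ l₂) l₃))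
               (≢-sym (<⇒≢ l₂)) (<⇒≢ l₃))
    (dim₄-middle d) (<-trans l₁ l₂) (<-trans l₂ l₃) l₁

  inK-14∣23 : ∀ {j₁ j₂ j₃ j₄} → InN (j₁ , j₂ , j₃ , j₄) → InK (j₁ , j₄ , j₂ , j₃)
  inK-14∣23 (d , l₁ , l₂ , l₃) = inK
    (disjoint₂ (<⇒≢ l₁) (<⇒≢ (<-trans l₁ l₂))
               (≢-sym (<⇒≢ (<-trans l₂ l₃))) (≢-sym (<⇒≢ l₃)))
    (dim₄-middle (dim₄-swap₂ d)) (<-trans (<-trans l₁ l₂) l₃) l₂ l₁

  record FiveCircuits : Set where
    field
      p q r s t : J
      distinct  : Unique (p ∷ q ∷ r ∷ s ∷ t ∷ [])
      dim≡1     : dim (C p ∪ C q ∪ C r ∪ C s ∪ C t) ≡ 1ℤ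
      p<q       : p < q
      r<s       : r < s
      s<t       : s < t

    F : Subset n
    F = C p ∪ C q ∪ C r ∪ C s ∪ C t

    private
      ⊆p : C p ⊆ F
      ⊆p = p⊆p∪q _
      ⊆rest : C q ∪ C r ∪ C s ∪ C t ⊆ F
      ⊆rest = q⊆p∪q (C p) _
      module R = ∪₄ (C q) (C r) (C s) (C t)

    -- The hypotheses under which ⟨pq|rs⟩, ⟨pq|st⟩ and ⟨pq|rt⟩ are defined.
    disjoint-rs : Disjoint₂ p q r s
    disjoint-rs with (_ ∷ pr ∷ ps ∷ _) ∷ (qr ∷ qs ∷ _) ∷ _ ← distinct = disjoint₂ pr ps qr qs
    disjoint-st : Disjoint₂ p q s t
    disjoint-st with (_ ∷ _ ∷ ps ∷ pt ∷ _) ∷ (_ ∷ qs ∷ qt ∷ _) ∷ _ ← distinct = disjoint₂ ps pt qs qt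
    disjoint-rt : Disjoint₂ p q r t
    disjoint-rt with (_ ∷ pr ∷ _ ∷ pt ∷ _) ∷ (qr ∷ _ ∷ qt ∷ _) ∷ _ ← distinct = disjoint₂ pr pt qr qt

    dim-rs : dim₄ p q r s ≡ 1ℤ
    dim-rs = dim₄-within (<⇒≢ p<q) ⊆p (⊆-trans R.i₁ ⊆rest) (⊆-trans R.i₂ ⊆rest) (⊆-trans R.i₃ ⊆rest) dim≡1
    dim-st : dim₄ p q s t ≡ 1ℤ
    dim-st = dim₄-within (<⇒≢ p<q) ⊆p (⊆-trans R.i₁ ⊆rest) (⊆-trans R.i₃ ⊆rest) (⊆-trans R.i₄ ⊆rest) dim≡1
    dim-rt : dim₄ p q r t ≡ 1ℤ
    dim-rt = dim₄-within (<⇒≢ p<q) ⊆p (⊆-trans R.i₁ ⊆rest) (⊆-trans R.i₂ ⊆rest) (⊆-trans R.i₄ ⊆rest) dim≡1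

  record NineCircuits : Set where
    field
      j₁ j₂ j₃ j₄ j₅ j₆ j₇ j₈ j₉ : J

    L₁ : Subset n
    L₁ = C j₂ ∪ C j₃
    L₂ : Subset n
    L₂ = C j₃ ∪ C j₁
    L₃ : Subset n
    L₃ = C j₁ ∪ C j₂

    field
      dim-L₁   : dim L₁ ≡ 1ℤ
      dim-L₂   : dim L₂ ≡ 1ℤ
      dim-L₃   : dim L₃ ≡ 1ℤ
      dim-123  : dim (C j₁ ∪ C j₂ ∪ C j₃) ≡ pos 2
      C₄⊆L₁    : C j₄ ⊆ L₁
      C₇⊆L₁    : C j₇ ⊆ L₁
      C₅⊆L₂    : C j₅ ⊆ L₂
      C₈⊆L₂    : C j₈ ⊆ L₂
      C₆⊆L₃    : C j₆ ⊆ L₃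
      C₉⊆L₃    : C j₉ ⊆ L₃
      dim-456  : dim (C j₄ ∪ C j₅ ∪ C j₆) ≡ 1ℤ
      dim-789  : dim (C j₇ ∪ C j₈ ∪ C j₉) ≡ 1ℤ
      disjoint : Disjoint (C j₁ ∷ C j₂ ∷ C j₃ ∷ [])
                          (C j₄ ∷ C j₅ ∷ C j₆ ∷ C j₇ ∷ C j₈ ∷ C j₉ ∷ [])
      j₁<j₂    : j₁ < j₂
      j₂<j₃    : j₂ < j₃
      notAll≥  : ¬ (j₄ ≥ j₇ × j₅ ≥ j₈ × j₆ ≥ j₉)

    private
      apart : ∀ {a b} → C a List.∈ (C j₁ ∷ C j₂ ∷ C j₃ ∷ []) →
              C b List.∈ (C j₄ ∷ C j₅ ∷ C j₆ ∷ C j₇ ∷ C j₈ ∷ C j₉ ∷ []) → a ≢ b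
      apart x y refl = disjoint (x , y)

    -- The hypotheses under which ⟨j₁j₂|j₆j₉⟩, ⟨j₂j₃|j₄j₇⟩ and ⟨j₃j₁|j₅j₈⟩
    -- are defined.
    disjoint-69 : Disjoint₂ j₁ j₂ j₆ j₉
    disjoint-69 = disjoint₂ (apart ∈₁ ∈₃) (apart ∈₁ ∈₆) (apart ∈₂ ∈₃) (apart ∈₂ ∈₆)
    disjoint-47 : Disjoint₂ j₂ j₃ j₄ j₇
    disjoint-47 = disjoint₂ (apart ∈₂ ∈₁) (apart ∈₂ ∈₄) (apart ∈₃ ∈₁) (apart ∈₃ ∈₄)
    disjoint-58 : Disjoint₂ j₃ j₁ j₅ j₈
    disjoint-58 = disjoint₂ (apart ∈₃ ∈₂) (apart ∈₃ ∈₅) (apart ∈₁ ∈₂) (apart ∈₁ ∈₅)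

    dim-69 : dim₄ j₁ j₂ j₆ j₉ ≡ 1ℤ
    dim-69 = dim₄-within (<⇒≢ j₁<j₂) (p⊆p∪q _) (q⊆p∪q _ _) C₆⊆L₃ C₉⊆L₃ dim-L₃
    dim-47 : dim₄ j₂ j₃ j₄ j₇ ≡ 1ℤ
    dim-47 = dim₄-within (<⇒≢ j₂<j₃) (p⊆p∪q _) (q⊆p∪q _ _) C₄⊆L₁ C₇⊆L₁ dim-L₁
    dim-58 : dim₄ j₃ j₁ j₅ j₈ ≡ 1ℤ
    dim-58 = dim₄-within (≢-sym (<⇒≢ (<-trans j₁<j₂ j₂<j₃)))
               (p⊆p∪q _) (q⊆p∪q _ _) C₅⊆L₂ C₈⊆L₂ dim-L₂

module CrossRatios {c ℓ h} (H : Hyperfield c ℓ h)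
                   {n} {M : Matroid n} (𝓒 : CircuitEnumeration M) where

  open Hyperfield H
  open CircuitEnumeration 𝓒
  open Configurations 𝓒

  Point : Set (c ⊔ ℓ)
  Point = K → H*

  -- The value at two pairs sorted increasingly: put first the pair with
  -- the smaller minimum.
  value : Point → ∀ {p q r s} → Disjoint₂ p q r s → dim₄ p q r s ≡ 1ℤ →
          p < q → r < s → H*
  value φ {p} {q} {r} {s} disj dim≡1 p<q r<s with compare p r
  ... | tri< p<r _ _ = φ ((p , q , r , s) , [ inK disj dim≡1 p<q r<s p<r ])
  ... | tri≈ _ p≡r _ = ⊥-elim (disj (here refl , here p≡r))
  ... | tri> _ _ r<p = φ ((r , s , p , q) ,
      [ inK (disjoint₂-exchange disj) (dim₄-exchange {p} {q} dim≡1) r<s p<q r<p ])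

  -- ⟨ab|ce⟩; interchanging the entries of a single pair inverts the value.
  bracket : Point → ∀ a b c e → Disjoint₂ a b c e → dim₄ a b c e ≡ 1ℤ → H*
  bracket φ a b c e disj dim≡1 with compare a b | compare c e
  ... | tri≈ _ _ _   | _            = 1*
  ... | tri< _ _ _   | tri≈ _ _ _   = 1*
  ... | tri> _ _ _   | tri≈ _ _ _   = 1*
  ... | tri< a<b _ _ | tri< c<e _ _ = value φ disj dim≡1 a<b c<e
  ... | tri> _ _ b<a | tri> _ _ e<c =
    value φ (disjoint₂-swap₂ (disjoint₂-swap₁ disj)) (dim₄-swap₂ {b} (dim₄-swap₁ {a} dim≡1)) b<a e<c
  ... | tri< a<b _ _ | tri> _ _ e<c =
    value φ (disjoint₂-swap₂ disj)
            (dim₄-swap₂ {a} dim≡1) a<b e<c ⁻¹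
  ... | tri> _ _ b<a | tri< c<e _ _ =
    value φ (disjoint₂-swap₁ disj)
            (dim₄-swap₁ {a} dim≡1) b<a c<e ⁻¹

  S3 : Pred Point ℓ
  S3 φ = ∀ j₁ j₂ j₃ j₄ (i : InN (j₁ , j₂ , j₃ , j₄)) →
    proj₁ (φ ((j₁ , j₂ , j₃ , j₄) , [ inK-12∣34 i ]) ⊙*
           φ ((j₁ , j₄ , j₂ , j₃) , [ inK-14∣23 i ]) ⊙*
           φ ((j₁ , j₃ , j₂ , j₄) , [ inK-13∣24 i ]) ⁻¹) ≈ - 1#

  S4 : Pred Point ℓ
  S4 φ = (x : FiveCircuits) → let open FiveCircuits x in
    bracket φ p q r s disjoint-rs dim-rs ⊙*
    bracket φ p q s t disjoint-st dim-st ⊙*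
    bracket φ p q r t disjoint-rt dim-rt ⁻¹ ≈* 1*

  S5 : Pred Point ℓ
  S5 φ = (x : NineCircuits) → let open NineCircuits x in
    bracket φ j₁ j₂ j₆ j₉ disjoint-69 dim-69 ⊙*
    bracket φ j₂ j₃ j₄ j₇ disjoint-47 dim-47 ⊙*
    bracket φ j₃ j₁ j₅ j₈ disjoint-58 dim-58 ≈* 1*

  CR : Pred Point h
  CR φ = ∀ j₁ j₂ j₃ j₄ (i : InN (j₁ , j₂ , j₃ , j₄)) →
    1# Pred.∈ proj₁ (φ ((j₁ , j₂ , j₃ , j₄) , [ inK-12∣34 i ])) ⊞
              proj₁ (φ ((j₁ , j₃ , j₂ , j₄) , [ inK-13∣24 i ]))

  𝓑 : Pred Point ℓ
  𝓑 φ = S3 φ × S4 φ × S5 φ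

  𝓖ᴿʷ : Pred Point (ℓ ⊔ h)
  𝓖ᴿʷ φ = S3 φ × S4 φ × S5 φ × CR φ

  -- The product of m copies of X × H*, where the j-th factor takes the
  -- coordinates 3j, 3j+1, 3j+2.
  ∏[X×H*] : ∀ m → Pred (Fin (m * 3) → H*) h
  ∏[X×H*] m ψ = ∀ (j : Fin m) →
    (X Pred.⟨×⟩ Pred.U) ((ψ (combine j 0F) , ψ (combine j 1F)) , ψ (combine j 2F))

{-# OPTIONS --safe #-}

-- Four circuits j₁ < j₂ < j₃ < j₄ of dimension 1 give exactly the three
-- elements (j₁j₂|j₃j₄), (j₁j₃|j₂j₄), (j₁j₄|j₂j₃) of K. Grouping the
-- variables by their underlying four-element set is therefore a bijection
-- between n_M × 3 and K, and (CR) is membership in X of the first two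
-- variables of each group.

module Submission where

open import Defs
open import Data.Fin.Base using (Fin; zero; suc; combine)
open import Data.Fin.Patterns using (0F; 1F; 2F)
open import Data.Fin.Permutation using (↔⇒≡)
open import Data.Fin.Properties using (*↔×; remQuot-combine)
open import Data.Irrelevant using ([_])
open import Data.List.Base using (List; length; filter; lookup)
open import Data.List.Membership.Propositional using (_∈_)
open import Data.List.Membership.Propositional.Properties
  using (∈-filter⁺; ∈-filter⁻; ∈-lookup; ∈-cartesianProduct⁺; ∈-allFin)
open import Data.List.Relation.Unary.AllPairs using (_∷_)
open import Data.List.Relation.Unary.All as All using ([]; _∷_)
open import Data.List.Relation.Unary.Any using (index)
open import Data.List.Relation.Unary.Any.Properties using (lookup-index)
open import Data.List.Relation.Unary.Unique.Propositional using (Unique)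
open import Data.List.Relation.Unary.Unique.Propositional.Properties
  using (filter⁺; cartesianProduct⁺; allFin⁺)
open import Data.Nat.Base using (_*_)
open import Data.Nat.Properties using (*-comm)
open import Data.Product.Base using (_×_; Σ-syntax; _,_; proj₁; proj₂)
open import Data.Product.Function.NonDependent.Propositional using (_×-↔_)
open import Data.Refinement using (Refinement; Refinement-syntax; _,_; value-injective)
open import Data.Unit.Base using (tt)
open import Function.Base using (_∘_)
open import Function.Bundles using (_↔_; Inverse; mk↔ₛ′)
open import Function.Properties.Inverse using (↔-refl; ↔-sym; ↔-trans)
open import Level using (Level)
open import Relation.Binary.Definitions using (tri<; tri≈; tri>)
open import Relation.Binary.PropositionalEquality
  using (_≡_; refl; sym; trans; cong; subst; subst₂)
open import Relation.Binary.Structures using (IsStrictTotalOrder)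
open import Relation.Nullary using (¬_; contradiction; recompute)
open import Relation.Unary using (Pred; Decidable; _≐_; _∩_; _⊢_)

private
  variable
    a p : Level
    A : Set a

lookup-injective : ∀ {xs : List A} → Unique xs →
                   ∀ {i j} → lookup xs i ≡ lookup xs j → i ≡ j
lookup-injective (x∉xs ∷ u) {zero}  {zero}  eq = refl
lookup-injective (x∉xs ∷ u) {zero}  {suc j} eq = contradiction eq (All.lookup x∉xs (∈-lookup j))
lookup-injective (x∉xs ∷ u) {suc i} {zero}  eq = contradiction (sym eq) (All.lookup x∉xs (∈-lookup i))
lookup-injective (x∉xs ∷ u) {suc i} {suc j} eq = cong suc (lookup-injective u eq)

module _ {P : Pred A p} (P? : Decidable P) {xs : List A} (u : Unique xs) (full : ∀ x → x ∈ xs) where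

  -- Since `xs` lists everything once, each element satisfying `P` sits at exactly one position of
  -- the filtered list. This turns the counts `kM` and `nM` into index sets for the quadruples they
  -- count.
  filter-↔ : Fin (length (filter P? xs)) ↔ [ x ∈ A ∣ P x ]
  filter-↔ = mk↔ₛ′ to from to∘from from∘to
    where
    to : Fin (length (filter P? xs)) → [ x ∈ A ∣ P x ]
    to i = lookup (filter P? xs) i , [ proj₂ (∈-filter⁻ P? {xs = xs} (∈-lookup i)) ]

    from : [ x ∈ A ∣ P x ] → Fin (length (filter P? xs))
    -- The proof `px` is irrelevant; deciding `P` at `x` yields one that may be used.
    from (x , [ px ]) = index (∈-filter⁺ P? (full x) (recompute (P? x) px))

    to∘from : ∀ y → to (from y) ≡ y
    to∘from (x , [ px ]) =
      value-injective (sym (lookup-index (∈-filter⁺ P? (full x) (recompute (P? x) px))))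

    from∘to : ∀ i → from (to i) ≡ i
    from∘to i = lookup-injective (filter⁺ P? u) (cong Refinement.value (to∘from (to i)))

module Grouping {n} {M : Matroid n} (𝓒 : CircuitEnumeration M) where

  open CircuitEnumeration 𝓒
  open Configurations 𝓒
  open IsStrictTotalOrder isStrictTotalOrder using (asym)

  N : Set
  N = [ q ∈ Quad ∣ InN q ]

  -- The order within a group matters: the variables in positions `0F` and `1F` are the two that
  -- occur together in (CR).
  group : N × Fin 3 → K
  group (((j₁ , j₂ , j₃ , j₄) , [ i ]) , 0F) = (j₁ , j₂ , j₃ , j₄) , [ inK-12∣34 i ]
  group (((j₁ , j₂ , j₃ , j₄) , [ i ]) , 1F) = (j₁ , j₃ , j₂ , j₄) , [ inK-13∣24 i ]
  group (((j₁ , j₂ , j₃ , j₄) , [ i ]) , 2F) = (j₁ , j₄ , j₂ , j₃) , [ inK-14∣23 i ]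

  -- The inequalities in `InK` make `p` the least of the four and give `r < s`, so only the place of
  -- `q` is open: before `r`, between `r` and `s`, or after `s`. Distinctness excludes ties.
  sort : ∀ {x} → InK x → N × Fin 3
  sort {p , q , r , s} ((_ ∷ (q≢r ∷ q≢s ∷ []) ∷ _) , d , p<q , r<s , p<r)
    with compare q r
  ... | tri< q<r _ _ = ((p , q , r , s) , [ (d , p<q , q<r , r<s) ]) , 0F
  ... | tri≈ _ q≡r _ = contradiction q≡r q≢r
  ... | tri> _ _ r<q with compare q s
  ...   | tri< q<s _ _ = ((p , r , q , s) , [ (dim₄-middle {p} d , p<r , r<q , q<s) ]) , 1F
  ...   | tri≈ _ q≡s _ = contradiction q≡s q≢s
  ...   | tri> _ _ s<q =
    ((p , r , s , q) , [ (dim₄-swap₂ {p} (dim₄-middle {p} d) , p<r , r<s , s<q) ]) , 2F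

  -- Repeating the comparisons of `sort` makes both sides compute to the same quadruple; their
  -- membership proofs are irrelevant, so `refl` suffices.
  group-sort : ∀ {x} (i : InK x) → group (sort i) ≡ (x , [ i ])
  group-sort {p , q , r , s} ((_ ∷ (q≢r ∷ q≢s ∷ []) ∷ _) , d , p<q , r<s , p<r)
    with compare q r
  ... | tri< q<r _ _ = refl
  ... | tri≈ _ q≡r _ = contradiction q≡r q≢r
  ... | tri> _ _ r<q with compare q s
  ...   | tri< q<s _ _ = refl
  ...   | tri≈ _ q≡s _ = contradiction q≡s q≢s
  ...   | tri> _ _ s<q = refl

  module _ {j₁ j₂ j₃ j₄} (i : InN (j₁ , j₂ , j₃ , j₄)) where

    private
      j₂<j₃ : j₂ < j₃
      j₂<j₃ = proj₁ (proj₂ (proj₂ i))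

      j₃<j₄ : j₃ < j₄
      j₃<j₄ = proj₂ (proj₂ (proj₂ i))

    -- The order given by `i` leaves a single outcome of the comparisons. The proof `k` is arbitrary
    -- because `ungroup` sorts with a recomputed one.
    sort-12∣34 : (k : InK (j₁ , j₂ , j₃ , j₄)) → sort k ≡ ((_ , [ i ]) , 0F)
    sort-12∣34 ((_ ∷ (q≢r ∷ q≢s ∷ []) ∷ _) , _) with compare j₂ j₃
    ... | tri< _ _ _   = refl
    ... | tri≈ _ q≡r _ = contradiction q≡r q≢r
    ... | tri> _ _ r<q = contradiction r<q (asym j₂<j₃)

    sort-13∣24 : (k : InK (j₁ , j₃ , j₂ , j₄)) → sort k ≡ ((_ , [ i ]) , 1F)
    sort-13∣24 ((_ ∷ (q≢r ∷ q≢s ∷ []) ∷ _) , _) with compare j₃ j₂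
    ... | tri< q<r _ _ = contradiction q<r (asym j₂<j₃)
    ... | tri≈ _ q≡r _ = contradiction q≡r q≢r
    ... | tri> _ _ _ with compare j₃ j₄
    ...   | tri< _ _ _   = refl
    ...   | tri≈ _ q≡s _ = contradiction q≡s q≢s
    ...   | tri> _ _ s<q = contradiction s<q (asym j₃<j₄)

    sort-14∣23 : (k : InK (j₁ , j₄ , j₂ , j₃)) → sort k ≡ ((_ , [ i ]) , 2F)
    sort-14∣23 ((_ ∷ (q≢r ∷ q≢s ∷ []) ∷ _) , _ , _ , _ , _) with compare j₄ j₂
    -- Here `q<r` says `j₄ < j₂`, hence `j₄ < j₃`.
    ... | tri< q<r _ _ = contradiction (<-trans q<r j₂<j₃) (asym j₃<j₄)
      where open IsStrictTotalOrder isStrictTotalOrder using () renaming (trans to <-trans)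
    ... | tri≈ _ q≡r _ = contradiction q≡r q≢r
    ... | tri> _ _ _ with compare j₄ j₃
    ...   | tri< q<s _ _ = contradiction q<s (asym j₃<j₄)
    ...   | tri≈ _ q≡s _ = contradiction q≡s q≢s
    ...   | tri> _ _ _   = refl

  group-↔ : (N × Fin 3) ↔ K
  group-↔ = mk↔ₛ′ group ungroup group-ungroup ungroup-group
    where
    ungroup : K → N × Fin 3
    ungroup (x , [ k ]) = sort (recompute (InK? x) k)

    group-ungroup : ∀ x → group (ungroup x) ≡ x
    group-ungroup (x , [ k ]) = group-sort (recompute (InK? x) k)

    ungroup-group : ∀ y → ungroup (group y) ≡ y
    ungroup-group (((j₁ , j₂ , j₃ , j₄) , [ i ]) , 0F) = sort-12∣34 (recompute (InN? _) i)
      (recompute (InK? (j₁ , j₂ , j₃ , j₄)) (inK-12∣34 i))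
    ungroup-group (((j₁ , j₂ , j₃ , j₄) , [ i ]) , 1F) = sort-13∣24 (recompute (InN? _) i)
      (recompute (InK? (j₁ , j₃ , j₂ , j₄)) (inK-13∣24 i))
    ungroup-group (((j₁ , j₂ , j₃ , j₄) , [ i ]) , 2F) = sort-14∣23 (recompute (InN? _) i)
      (recompute (InK? (j₁ , j₄ , j₂ , j₃)) (inK-14∣23 i))

  allQuads-unique : Unique allQuads
  allQuads-unique = cartesianProduct⁺ js (cartesianProduct⁺ js (cartesianProduct⁺ js js))
    where js = allFin⁺ size

  ∈-allQuads : ∀ x → x ∈ allQuads
  ∈-allQuads (p , q , r , s) = ∈-cartesianProduct⁺ (∈-allFin p)
    (∈-cartesianProduct⁺ (∈-allFin q) (∈-cartesianProduct⁺ (∈-allFin r) (∈-allFin s)))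

  K-↔ : Fin kM ↔ K
  K-↔ = filter-↔ InK? allQuads-unique ∈-allQuads

  N-↔ : Fin nM ↔ N
  N-↔ = filter-↔ InN? allQuads-unique ∈-allQuads

  coordinates : Fin (nM * 3) ↔ K
  coordinates = ↔-trans *↔× (↔-trans (N-↔ ×-↔ ↔-refl) group-↔)

  -- `coordinates` first splits an index by quotient and remainder, which undoes `combine` only up
  -- to a propositional equality.
  coordinates-combine : ∀ j k → Inverse.to coordinates (combine j k) ≡ group (Inverse.to N-↔ j , k)
  coordinates-combine j k =
    cong (λ jk → group (Inverse.to N-↔ (proj₁ jk) , proj₂ jk)) (remQuot-combine j k)

  -- Both numbers count `K`, once by direct enumeration and once group by group, and finite sets in
  -- bijection have equal size.
  kM≡3*nM : kM ≡ 3 * nM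
  kM≡3*nM = trans (↔⇒≡ (↔-trans K-↔ (↔-sym coordinates))) (*-comm nM 3)

  module _ {c ℓ h} (H : Hyperfield c ℓ h) where

    open Hyperfield H using (H*; X)
    open CrossRatios H 𝓒

    -- (CR) ranges over increasing quadruples, the product over positions in their enumeration;
    -- `N-↔` translates between the two.
    CR≐∏ : CR ≐ ((λ φ → φ ∘ Inverse.to coordinates) ⊢ ∏[X×H*] nM)
    CR≐∏ = (λ {φ} → CR⇒∏ {φ}) , (λ {φ} → ∏⇒CR {φ})
      where
      Xᴺ : Point → Pred N h
      Xᴺ φ x = X (φ (group (x , 0F)) , φ (group (x , 1F)))

      CR⇒∏ : ∀ {φ} → CR φ → ∏[X×H*] nM (φ ∘ Inverse.to coordinates)
      CR⇒∏ {φ} cr j = subst₂ (λ u v → X (φ u , φ v))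
        (sym (coordinates-combine j 0F)) (sym (coordinates-combine j 1F))
        (onN (Inverse.to N-↔ j)) , tt
        where
        onN : ∀ x → Xᴺ φ x
        onN (x , [ i ]) = cr _ _ _ _ (recompute (InN? x) i)

      ∏⇒CR : ∀ {φ} → ∏[X×H*] nM (φ ∘ Inverse.to coordinates) → CR φ
      -- The factor at position `j` speaks of the quadruple stored there, which equals `x` only
      -- propositionally, so the condition is transported to `x`.
      ∏⇒CR {φ} ψ∈∏ j₁ j₂ j₃ j₄ i = subst (Xᴺ φ) (Inverse.strictlyInverseˡ N-↔ x)
        (subst₂ (λ u v → X (φ u , φ v))
          (coordinates-combine j 0F) (coordinates-combine j 1F) (proj₁ (ψ∈∏ j)))
        where
        x : N
        x = (j₁ , j₂ , j₃ , j₄) , [ i ]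
        j : Fin nM
        j = Inverse.from N-↔ x

proposition4p11 :
    ∀ {c ℓ h} (H : Hyperfield c ℓ h) {n} (M : Matroid n) →
    ¬ HasMinor M Fano → ¬ HasMinor M (dual Fano) →
    (𝓒 : CircuitEnumeration M) →
    let open CircuitEnumeration 𝓒
        open CrossRatios H 𝓒
    in kM ≡ 3 * nM ×
       (Σ[ σ ∈ Fin (nM * 3) ↔ K ]
          𝓖ᴿʷ ≐ 𝓑 ∩ ((λ φ → φ ∘ Inverse.to σ) ⊢ ∏[X×H*] nM))
proposition4p11 H M _ _ 𝓒 = kM≡3*nM , coordinates ,
  -- (S3), (S4) and (S5) are common to both sides; only (CR) has to be exchanged for the product
  -- condition.
  (λ {φ} (s3 , s4 , s5 , cr) → (s3 , s4 , s5) , proj₁ (CR≐∏ H) {φ} cr) ,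
  (λ {φ} ((s3 , s4 , s5) , φ∈∏) → s3 , s4 , s5 , proj₂ (CR≐∏ H) {φ} φ∈∏)
  where open Grouping 𝓒
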